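{- Let $\alpha\ge 1$ be an integer and let $G$ be a graph with independence number $\alpha(G)=\alpha$ whose edges are colored with two colors. Then $V(G)$ can be covered by the vertex sets of $\lfloor 3\alpha/2\rfloor$ monochromatic connected subgraphs of $G$, each of diameter at most $4$. In other words, $g(2,4,\alpha)\le \lfloor 3\alpha/2\rfloor$.
   Context: Graphs are finite and simple. A monochromatic subgraph is a subgraph (not necessarily induced) all of whose edges have the same color; a single vertex counts as a monochromatic subgraph. Different subgraphs in a cover may have different colors, and need not be disjoint or distinct. The diameter of a graph $H$ is the smallest integer $d$ with $d_H(u,v)\le d$ for all $u,v\in V(H)$, where distances are measured in $H$ itself ($\infty$ if there is no path); a one-vertex graph has diameter $0$. $g(r,d,\alpha)$ denotes the minimum $k$ such that for every graph $G$ with $\alpha(G)=\alpha$ and every coloring of the edges of $G$ with $r$ colors, $V(G)$ can be covered by the vertex sets of $k$ monochromatic subgraphs of diameter at most $d$. -}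

module Defs where

open import Level using (Level; 0ℓ)
open import Data.Nat using (ℕ; zero; suc; _≤_)
open import Data.Fin using (Fin)
open import Data.Fin.Subset using (Subset; _∈_; ∣_∣; Nonempty)
open import Data.Product using (Σ-syntax; ∃-syntax; _×_)
open import Relation.Nullary using (¬_)
open import Relation.Binary.Core using (Rel)
open import Relation.Binary.Definitions using (Symmetric; Irreflexive; Decidable)
open import Relation.Binary.PropositionalEquality using (_≡_)

private
  variable
    ℓ : Level
    n r k : ℕ

IsLeast : (ℕ → Set ℓ) → ℕ → Set ℓ
IsLeast P m = P m × (∀ j → P j → m ≤ j)

IsGreatest : (ℕ → Set ℓ) → ℕ → Set ℓ
IsGreatest P m = P m × (∀ j → P j → j ≤ m)

-- Finite simple graphs on the vertex set Fin n.  Decidability of adjacency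
-- is automatic classically; it is what makes the graph a finite object here.
record Graph (n : ℕ) : Set₁ where
  field
    Adj    : Rel (Fin n) 0ℓ
    adj?   : Decidable Adj
    sym    : Symmetric Adj
    irrefl : Irreflexive _≡_ Adj

Independent : Graph n → Subset n → Set
Independent G S = ∀ {u v} → u ∈ S → v ∈ S → ¬ Graph.Adj G u v

IsIndependenceNumber : Graph n → ℕ → Set
IsIndependenceNumber {n} G =
  IsGreatest (λ m → Σ[ S ∈ Subset n ] (Independent G S × ∣ S ∣ ≡ m))

-- The law makes the colour a function of the unordered pair {u , v}: using it
-- twice, the colour does not depend on the proof of adjacency either.
record EdgeColouring (G : Graph n) (r : ℕ) : Set where
  open Graph G
  field
    colour    : ∀ {u v} → Adj u v → Fin r
    unordered : ∀ {u v} (e : Adj u v) (e′ : Adj v u) → colour e ≡ colour e′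

-- Not necessarily induced subgraphs.
record Subgraph (G : Graph n) : Set₁ where
  field
    V        : Subset n
    nonempty : Nonempty V
    Edge     : Rel (Fin n) 0ℓ
    edge?    : Decidable Edge
    edge-sym : Symmetric Edge
    edge⊆Adj : ∀ {u v} → Edge u v → Graph.Adj G u v
    edge⊆V   : ∀ {u v} → Edge u v → u ∈ V × v ∈ V

-- In particular, an edgeless subgraph is monochromatic.
Monochromatic : {G : Graph n} → EdgeColouring G r → Subgraph G → Set
Monochromatic c H =
  ∀ {u v x y} (e : Edge u v) (f : Edge x y) →
  colour (edge⊆Adj e) ≡ colour (edge⊆Adj f)
  where
  open Subgraph H
  open EdgeColouring c

data Walk {G : Graph n} (H : Subgraph G) : Fin n → Fin n → ℕ → Set where
  []  : ∀ {u} → u ∈ Subgraph.V H → Walk H u u zero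
  _∷_ : ∀ {u v w l} → Subgraph.Edge H u v → Walk H v w l → Walk H u w (suc l)

Connected : {G : Graph n} → Subgraph G → Set
Connected H = ∀ {u v} → u ∈ V → v ∈ V → ∃[ l ] Walk H u v l
  where open Subgraph H

-- Infinite distances and diameters are expressed by the absence of a value.
IsDistance : {G : Graph n} → Subgraph G → Fin n → Fin n → ℕ → Set
IsDistance H u v = IsLeast (Walk H u v)

DistanceAtMost : {G : Graph n} → Subgraph G → Fin n → Fin n → ℕ → Set
DistanceAtMost H u v d = ∃[ l ] (IsDistance H u v l × l ≤ d)

IsDiameter : {G : Graph n} → Subgraph G → ℕ → Set
IsDiameter H = IsLeast (λ d → ∀ {u v} → u ∈ V → v ∈ V → DistanceAtMost H u v d)
  where open Subgraph H

DiameterAtMost : {G : Graph n} → Subgraph G → ℕ → Set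
DiameterAtMost H d = ∃[ m ] (IsDiameter H m × m ≤ d)

-- The members of the family may have different colours, overlap or coincide.
Covers : {G : Graph n} → (Fin k → Subgraph G) → Set
Covers H = ∀ v → ∃[ i ] v ∈ Subgraph.V (H i)

CoverBound : ℕ → ℕ → ℕ → ℕ → Set₁
CoverBound r d α k =
  ∀ {n} (G : Graph n) → IsIndependenceNumber G α → (c : EdgeColouring G r) →
  Σ[ H ∈ (Fin k → Subgraph G) ]
    ((∀ i → Monochromatic c (H i) × DiameterAtMost (H i) d) × Covers H)

-- g r d α m  states that m is the value of the function g at (r , d , α).
-- It is a relation because a least k cannot be computed constructively.
g : ℕ → ℕ → ℕ → ℕ → Set₁
g r d α = IsLeast (CoverBound r d α)

{-# OPTIONS --safe #-}
-- All covering subgraphs are balls of radius 2 in a single colour.  One builds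
-- an independent set I and a cover C of the vertices by balls together, with
-- 2 |C| ≤ 3 |I|, by induction on the number of vertices.  If an independent set
-- of one vertex, respectively two vertices, has its closed neighbourhood covered
-- by one ball, respectively three balls, that neighbourhood is deleted.  This
-- happens
--  * when two nonadjacent vertices have a common neighbour in the same colour;
--  * otherwise (so that the neighbourhoods in either colour are cliques), when
--    two vertices are at distance 3 in some colour.
-- In the remaining case every monochromatic component is a ball, and two
-- vertices are adjacent only if they share a component.  So the vertices are
-- the edges of a bipartite multigraph between the components of the two
-- colours, and Kőnig's theorem gives |C| ≤ |I|.
module Submission where

open import Defs
open import Data.Nat using (ℕ; zero; suc; _+_; _*_; _≤_; _<_; z≤n; s≤s; s≤s⁻¹)
import Data.Nat.Properties as ℕ
open import Data.Nat.DivMod using (_/_; m*n/n≡m; /-monoˡ-≤)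
open import Data.Fin using (Fin; zero; suc; opposite)
open import Data.Fin.Properties using (_≟_; any?; all?)
open import Data.Fin.Subset as Subset using (Subset; ⊥; ⁅_⁆; _∪_; ∣_∣)
import Data.Fin.Subset.Properties as Subset
open import Data.List using (List; []; _∷_; _++_; length; filter; allFin; removeAt)
open import Data.List.Properties
  using (filter-notAll; length-filter; length-removeAt′; length-++)
open import Data.List.Membership.Propositional using (_∈_; find; lose)
open import Data.List.Membership.Propositional.Properties
  using (∈-filter⁺; ∈-filter⁻; ∈-allFin; ∈-++⁻)
import Data.List.Membership.DecPropositional as DecMembership
open import Data.List.Relation.Unary.All as All using (All; []; _∷_)
open import Data.List.Relation.Unary.Any as Any using (Any; here; there)
import Data.List.Relation.Unary.Any.Properties as Any
open import Data.List.Relation.Unary.AllPairs as AllPairs using (AllPairs; []; _∷_)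
import Data.List.Relation.Unary.AllPairs.Properties as AllPairs
open import Data.Product as Product
  using (Σ-syntax; ∃; ∃-syntax; _×_; _,_; proj₁; proj₂)
open import Data.Product.Properties using (≡-dec)
open import Data.Sum as Sum using (_⊎_; inj₁; inj₂; [_,_]′)
open import Data.Vec as Vec using (tabulate; []; _∷_)
open import Data.Vec.Properties using (lookup∘tabulate; []=⇒lookup; lookup⇒[]=)
open import Function using (_∘_; id)
open import Level using (0ℓ)
open import Relation.Binary.Core using (Rel)
open import Relation.Binary.Definitions using (Symmetric; Decidable; DecidableEquality)
open import Relation.Binary.PropositionalEquality
  using (_≡_; _≢_; refl; sym; trans; cong; subst; subst₂)
open import Relation.Nullary using (¬_; Dec; yes; no; contradiction)
open import Relation.Nullary.Decidable
  using (does; map′; ¬?; _×-dec_; _⊎-dec_; _→-dec_; dec-true; decidable-stable)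
open import Relation.Unary using (Pred)

pattern 0F = zero
pattern 1F = suc zero

-- Removal from lists and pairwise relations.

module _ {A : Set} where

  ∈-removeAt : ∀ {x y : A} {xs} (p : x ∈ xs) → y ∈ xs → y ≢ x →
    y ∈ removeAt xs (Any.index p)
  ∈-removeAt (here refl) (here refl) y≢x = contradiction refl y≢x
  ∈-removeAt (here _)    (there q)   y≢x = q
  ∈-removeAt (there p)   (here refl) y≢x = here refl
  ∈-removeAt (there p)   (there q)   y≢x = there (∈-removeAt p q y≢x)

  AllPairs-lookup : ∀ {R : Rel A 0ℓ} → Symmetric R → ∀ {xs} → AllPairs R xs →
    ∀ {x y} → x ∈ xs → y ∈ xs → x ≢ y → R x y
  AllPairs-lookup R-sym (r ∷ rs) (here refl) (here refl) x≢y = contradiction refl x≢y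
  AllPairs-lookup R-sym (r ∷ rs) (here refl) (there q)   x≢y = All.lookup r q
  AllPairs-lookup R-sym (r ∷ rs) (there p)   (here refl) x≢y = R-sym (All.lookup r p)
  AllPairs-lookup R-sym (r ∷ rs) (there p)   (there q)   x≢y = AllPairs-lookup R-sym rs p q x≢y

  AllPairs-map∈ : ∀ {R S : Rel A 0ℓ} {xs} →
    (∀ {x y} → x ∈ xs → y ∈ xs → R x y → S x y) → AllPairs R xs → AllPairs S xs
  AllPairs-map∈ f []       = []
  AllPairs-map∈ f (r ∷ rs) =
    All.tabulate (λ p → f (here refl) (there p) (All.lookup r p)) ∷
    AllPairs-map∈ (λ p q → f (there p) (there q)) rs

-- Kőnig's theorem for bipartite multigraphs.

-- Elements of A are the edges of a bipartite multigraph: the ends of x are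
-- ℓ 0F x, in the first class, and ℓ 1F x, in the second.
module Kőnig {A X : Set} (_≟A_ : DecidableEquality A) (_≟X_ : DecidableEquality X) where

  Labelling : Set
  Labelling = Fin 2 → A → X

  Disjoint : Labelling → Rel A 0ℓ
  Disjoint ℓ x y = ∀ c → ℓ c x ≢ ℓ c y

  Disjoint-sym : ∀ ℓ → Symmetric (Disjoint ℓ)
  Disjoint-sym ℓ d c = d c ∘ sym

  Covered : Labelling → List (Fin 2 × X) → A → Set
  Covered ℓ W x = ∃[ c ] (c , ℓ c x) ∈ W

  -- A certificate of Kőnig's equality: `matching≤cover` supplies the inequality opposite to
  -- `tight`.
  record TightCover (ℓ : Labelling) (L : List A) : Set where
    constructor tightCover
    field
      matching : List A
      cover    : List (Fin 2 × X)
      inside   : ∀ {x} → x ∈ matching → x ∈ L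
      disjoint : AllPairs (Disjoint ℓ) matching
      covered  : ∀ {x} → x ∈ L → Covered ℓ cover x
      tight    : length cover ≤ length matching

  same-end : ∀ (ℓ : Labelling) {c d x a} →
    _≡_ {A = Fin 2 × X} (d , ℓ d x) (c , a) → ℓ c x ≡ a
  same-end ℓ refl = refl

  -- The element of `W` that covers the first edge covers no later one, as disjoint edges share no
  -- end; so it can be removed.
  matching≤cover : ∀ ℓ {M W} → AllPairs (Disjoint ℓ) M →
    (∀ {x} → x ∈ M → Covered ℓ W x) → length M ≤ length W
  matching≤cover ℓ {[]}    {W} [] cov = z≤n
  matching≤cover ℓ {x ∷ M} {W} (d ∷ ds) cov with cov (here refl)
  ... | c , p = subst (suc (length M) ≤_) (sym (length-removeAt′ W (Any.index p)))
                  (s≤s (matching≤cover ℓ ds rest))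
    where
    rest : ∀ {y} → y ∈ M → Covered ℓ (removeAt W (Any.index p)) y
    rest q with cov (there q)
    ... | c′ , p′ = c′ , ∈-removeAt p p′ (All.lookup d q c ∘ sym ∘ same-end ℓ)

  -- No edge of `M` uses `(1F , v)`, so `W` without it still covers `M`.
  matching<cover : ∀ ℓ {M W v} → AllPairs (Disjoint ℓ) M →
    (∀ {x} → x ∈ M → Covered ℓ W x) → (∀ {x} → x ∈ M → ℓ 1F x ≢ v) →
    (1F , v) ∈ W → length M < length W
  matching<cover ℓ {M} {W} ds cov avoids p =
    subst (suc (length M) ≤_) (sym (length-removeAt′ W (Any.index p)))
      (s≤s (matching≤cover ℓ ds λ q → proj₁ (cov q) ,
        ∈-removeAt p (proj₂ (cov q)) (avoids q ∘ same-end ℓ)))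

  merge : X → X → X → X
  merge v w a with a ≟X w
  ... | yes _ = v
  ... | no  _ = a

  merge-w : ∀ {v w a} → a ≡ w → merge v w a ≡ v
  merge-w {v} {w} {a} a≡w with a ≟X w
  ... | yes _ = refl
  ... | no a≢w = contradiction a≡w a≢w

  merge-≢ : ∀ {v w a} → a ≢ w → merge v w a ≡ a
  merge-≢ {v} {w} {a} a≢w with a ≟X w
  ... | yes a≡w = contradiction a≡w a≢w
  ... | no _ = refl

  contract : X → X → Labelling → Labelling
  contract v w ℓ 0F = ℓ 0F
  contract v w ℓ 1F = merge v w ∘ ℓ 1F

  uncontract-disjoint : ∀ {v w ℓ x y} → Disjoint (contract v w ℓ) x y → Disjoint ℓ x y
  uncontract-disjoint         d 0F = d 0F
  uncontract-disjoint {v} {w} d 1F = d 1F ∘ cong (merge v w)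

  -- Degree one: the only edge e at its first end can be matched, and its
  -- second end covers everything that e meets.
  leaf : ∀ ℓ e L → (∀ {x} → x ∈ L → ℓ 0F x ≢ ℓ 0F e) →
    TightCover ℓ (filter (λ x → ¬? (ℓ 1F x ≟X ℓ 1F e)) L) → TightCover ℓ (e ∷ L)
  leaf ℓ e L alone (tightCover M W M⊆ ds cov tight) = tightCover
    (e ∷ M) ((1F , ℓ 1F e) ∷ W)
    (λ { (here refl) → here refl ; (there p) → there (proj₁ (∈-filter⁻ away? (M⊆ p))) })
    (All.tabulate (λ p → λ
       { 0F → alone (proj₁ (∈-filter⁻ away? (M⊆ p))) ∘ sym
       ; 1F → proj₂ (∈-filter⁻ away? {xs = L} (M⊆ p)) ∘ sym }) ∷ ds)
    cov′ (s≤s tight)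
    where
    away? = λ x → ¬? (ℓ 1F x ≟X ℓ 1F e)
    cov′ : ∀ {x} → x ∈ e ∷ L → Covered ℓ ((1F , ℓ 1F e) ∷ W) x
    cov′ (here refl) = 1F , here refl
    cov′ {x} (there p) with ℓ 1F x ≟X ℓ 1F e
    ... | yes eq = 1F , here (cong (1F ,_) eq)
    ... | no ne with cov (∈-filter⁺ away? p ne)
    ...   | c , q = c , there q

  -- Degree two: delete the common end u of e and f and identify their other
  -- ends v and w.  At most one of v and w is met by a matching of the rest,
  -- so that e or f can be added to it.
  degree-two : ∀ ℓ e f L → f ∈ L → ℓ 0F f ≡ ℓ 0F e → ℓ 1F f ≢ ℓ 1F e →
    (∀ {x} → x ∈ L → ℓ 0F x ≡ ℓ 0F e → x ≡ f) →
    TightCover (contract (ℓ 1F e) (ℓ 1F f) ℓ) (filter (λ x → ¬? (ℓ 0F x ≟X ℓ 0F e)) L) →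
    TightCover ℓ (e ∷ L)
  degree-two ℓ e f L f∈L f-u w≢v only (tightCover M W M⊆ ds cov tight) =
    add matched uncovered
    where
    u = ℓ 0F e
    v = ℓ 1F e
    w = ℓ 1F f
    ℓ′ = contract v w ℓ
    away? = λ x → ¬? (ℓ 0F x ≟X u)
    _∈W?_ = DecMembership._∈?_ (≡-dec _≟_ _≟X_)

    M⊆L : ∀ {x} → x ∈ M → x ∈ L × ℓ 0F x ≢ u
    M⊆L p = ∈-filter⁻ away? (M⊆ p)

    matched : ∃[ h ] (h ∈ e ∷ L × All (Disjoint ℓ h) M)
    matched with Any.any? (λ x → ℓ 1F x ≟X w) M
    ... | no none = f , there f∈L , All.tabulate λ p → λ
      { 0F eq → proj₂ (M⊆L p) (trans (sym eq) f-u)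
      ; 1F eq → none (lose p (sym eq)) }
    ... | yes some with find some
    ...   | x , x∈M , x-w = e , here refl , All.tabulate λ p → λ
      { 0F eq → proj₂ (M⊆L p) (sym eq)
      ; 1F eq → AllPairs-lookup (Disjoint-sym ℓ′) ds x∈M p
          (λ { refl → w≢v (sym (trans eq x-w)) }) 1F
          (trans (merge-w x-w)
            (sym (trans (merge-≢ (λ eq′ → w≢v (trans (sym eq′) (sym eq)))) (sym eq)))) }

    uncovered : ∃[ a ] (∀ {x} → x ∈ e ∷ L → Covered ℓ (a ∷ W) x)
    uncovered with (1F , v) ∈W? W
    -- Now `v` takes `e`, while `w` takes `f`, the only other edge at `u`, and every edge that the
    -- contraction moved from `w` to `v`.
    ... | yes v∈W = (1F , w) , cov′
      where
      cov′ : ∀ {x} → x ∈ e ∷ L → Covered ℓ ((1F , w) ∷ W) x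
      cov′ (here refl) = 1F , there v∈W
      cov′ {x} (there p) with ℓ 0F x ≟X u
      ... | yes x-u rewrite only p x-u = 1F , here refl
      ... | no x≁u with ℓ 1F x ≟X w
      ...   | yes x-w = 1F , here (cong (1F ,_) x-w)
      ...   | no x≁w with cov (∈-filter⁺ away? p x≁u)
      ...     | 0F , q = 0F , there q
      ...     | 1F , q = 1F , there (subst (λ a → (1F , a) ∈ W) (merge-≢ x≁w) q)
    -- As `v` is not in `W`, the edges at `w` away from `u` are covered at their first ends, which
    -- the contraction leaves unchanged.
    ... | no v∉W = (0F , u) , cov′
      where
      cov′ : ∀ {x} → x ∈ e ∷ L → Covered ℓ ((0F , u) ∷ W) x
      cov′ (here refl) = 0F , here refl
      cov′ {x} (there p) with ℓ 0F x ≟X u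
      ... | yes x-u = 0F , here (cong (0F ,_) x-u)
      ... | no x≁u with cov (∈-filter⁺ away? p x≁u)
      ...   | 0F , q = 0F , there q
      ...   | 1F , q with ℓ 1F x ≟X w
      ...     | yes _ = contradiction q v∉W
      ...     | no _  = 1F , there q

    add : ∃[ h ] (h ∈ e ∷ L × All (Disjoint ℓ h) M) →
      ∃[ a ] (∀ {x} → x ∈ e ∷ L → Covered ℓ (a ∷ W) x) → TightCover ℓ (e ∷ L)
    add (h , h∈ , dh) (a , cov′) = tightCover (h ∷ M) (a ∷ W)
      (λ { (here refl) → h∈ ; (there p) → there (proj₁ (M⊆L p)) })
      (dh ∷ AllPairs.map uncontract-disjoint ds)
      cov′ (s≤s tight)

  -- Degree at least three (Rizzi): M avoids the second end v of e and some
  -- further edge h at the first end u.  Either v can be added to the cover W of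
  -- the edges avoiding v, or a tight cover of the edges other than h has only
  -- length M elements, each used on M; so it contains u rather than v.
  rizzi : ∀ ℓ e h L → h ∈ L → ℓ 0F h ≡ ℓ 0F e → ℓ 1F h ≢ ℓ 1F e →
    (t : TightCover ℓ (filter (λ x → ¬? (ℓ 1F x ≟X ℓ 1F e)) L)) →
    ¬ h ∈ TightCover.matching t →
    TightCover ℓ (e ∷ filter (λ x → ¬? (x ≟A h)) L) → TightCover ℓ (e ∷ L)
  rizzi ℓ e h L h∈L h-u h≁v (tightCover M W M⊆ ds cov tight) h∉M
        (tightCover M′ W′ M′⊆ ds′ cov′ tight′) with length M ℕ.<? length M′
  ... | yes M<M′ = tightCover M′ ((1F , ℓ 1F e) ∷ W)
    (λ p → weaken (M′⊆ p)) ds′ cov″ (ℕ.≤-trans (s≤s tight) M<M′)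
    where
    away? = λ x → ¬? (ℓ 1F x ≟X ℓ 1F e)
    weaken : ∀ {x} → x ∈ e ∷ filter (λ x → ¬? (x ≟A h)) L → x ∈ e ∷ L
    weaken (here eq) = here eq
    weaken (there p) = there (proj₁ (∈-filter⁻ _ p))
    cov″ : ∀ {x} → x ∈ e ∷ L → Covered ℓ ((1F , ℓ 1F e) ∷ W) x
    cov″ (here refl) = 1F , here refl
    cov″ {x} (there p) with ℓ 1F x ≟X ℓ 1F e
    ... | yes eq = 1F , here (cong (1F ,_) eq)
    ... | no ne with cov (∈-filter⁺ away? p ne)
    ...   | c , q = c , there q
  ... | no M≮M′ = tightCover M W′ (there ∘ proj₁ ∘ M⊆L) ds cov″ W′≤M
    where
    away? = λ x → ¬? (ℓ 1F x ≟X ℓ 1F e)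
    other? = λ x → ¬? (x ≟A h)
    W′≤M : length W′ ≤ length M
    W′≤M = ℕ.≤-trans tight′ (ℕ.≮⇒≥ M≮M′)
    M⊆L : ∀ {x} → x ∈ M → x ∈ L × ℓ 1F x ≢ ℓ 1F e
    M⊆L p = ∈-filter⁻ away? (M⊆ p)
    covM : ∀ {x} → x ∈ M → Covered ℓ W′ x
    covM p = cov′ (there (∈-filter⁺ other? (proj₁ (M⊆L p)) λ { refl → h∉M p }))
    u∈W′ : (0F , ℓ 0F e) ∈ W′
    u∈W′ with cov′ (here refl)
    ... | 0F , q = q
    ... | 1F , q = contradiction W′≤M
            (ℕ.<⇒≱ (matching<cover ℓ ds covM (proj₂ ∘ M⊆L) q))
    cov″ : ∀ {x} → x ∈ e ∷ L → Covered ℓ W′ x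
    cov″ (here refl) = 0F , u∈W′
    cov″ {x} (there p) with x ≟A h
    ... | yes refl = 0F , subst (λ a → (0F , a) ∈ W′) (sym h-u) u∈W′
    ... | no x≢h = cov′ (there (∈-filter⁺ other? p x≢h))

  -- Parallel edges are covered by the same elements, so `e` may be dropped.
  duplicate : ∀ ℓ e f L → f ∈ L → ℓ 0F f ≡ ℓ 0F e → ℓ 1F f ≡ ℓ 1F e →
    TightCover ℓ L → TightCover ℓ (e ∷ L)
  duplicate ℓ e f L f∈L f-u f-v (tightCover M W M⊆ ds cov tight) =
    tightCover M W (there ∘ M⊆) ds cov′ tight
    where
    cov′ : ∀ {x} → x ∈ e ∷ L → Covered ℓ W x
    cov′ (there p) = cov p
    cov′ (here refl) with cov f∈L
    ... | 0F , q = 0F , subst (λ a → (0F , a) ∈ W) f-u q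
    ... | 1F , q = 1F , subst (λ a → (1F , a) ∈ W) f-v q

  -- The bound `k` makes the recursion on filtered lists structural, and `ℓ` varies because
  -- `degree-two` contracts it. The cases are an edge parallel to `e`, then degree one, two or more
  -- at the first end of `e`.
  kőnig′ : ∀ k ℓ L → length L ≤ k → TightCover ℓ L
  kőnig′ k ℓ [] _ = tightCover [] [] id [] (λ ()) z≤n
  kőnig′ (suc k) ℓ (e ∷ L) (s≤s L≤k)
    with Any.any? (λ x → (ℓ 0F x ≟X ℓ 0F e) ×-dec (ℓ 1F x ≟X ℓ 1F e)) L
  ... | yes dup = let f , f∈L , f-u , f-v = find dup in
    duplicate ℓ e f L f∈L f-u f-v (kőnig′ k ℓ L L≤k)
  ... | no simple with Any.any? (λ x → ℓ 0F x ≟X ℓ 0F e) L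
  ...   | no alone = leaf ℓ e L (λ p eq → alone (lose p eq))
            (kőnig′ k ℓ _ (ℕ.≤-trans (length-filter _ L) L≤k))
  ...   | yes some with find some
  ...     | f , f∈L , f-u with Any.any? (λ x → (ℓ 0F x ≟X ℓ 0F e) ×-dec ¬? (x ≟A f)) L
  ...       | no only = degree-two ℓ e f L f∈L f-u (λ f-v → simple (lose f∈L (f-u , f-v)))
                only-f (kőnig′ k _ _ (ℕ.≤-trans (length-filter _ L) L≤k))
    where
    only-f : ∀ {x} → x ∈ L → ℓ 0F x ≡ ℓ 0F e → x ≡ f
    only-f {x} p x-u with x ≟A f
    ... | yes eq = eq
    ... | no ne = contradiction (lose p (x-u , ne)) only
  ...       | yes more with find more
  ...         | g , g∈L , g-u , g≢f = use free
    where
    open DecMembership _≟A_ using (_∈?_)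
    t = kőnig′ k ℓ (filter (λ x → ¬? (ℓ 1F x ≟X ℓ 1F e)) L)
          (ℕ.≤-trans (length-filter _ L) L≤k)
    free : ∃[ h ] (h ∈ L × ℓ 0F h ≡ ℓ 0F e × ¬ h ∈ TightCover.matching t)
    -- `f` and `g` share an end, so the matching contains at most one of them.
    free with f ∈? TightCover.matching t
    ... | no f∉ = f , f∈L , f-u , f∉
    ... | yes f∈ = g , g∈L , g-u , λ g∈ →
      AllPairs-lookup (Disjoint-sym ℓ) (TightCover.disjoint t) g∈ f∈ g≢f 0F (trans g-u (sym f-u))
    use : ∃[ h ] (h ∈ L × ℓ 0F h ≡ ℓ 0F e × ¬ h ∈ TightCover.matching t) → TightCover ℓ (e ∷ L)
    use (h , h∈L , h-u , h∉) =
      rizzi ℓ e h L h∈L h-u (λ h-v → simple (lose h∈L (h-u , h-v))) t h∉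
        -- Since `e` is put back, the removal of `h` has to shorten `L` strictly.
        (kőnig′ k ℓ _ (ℕ.≤-trans (filter-notAll _ L (lose h∈L λ ne → ne refl)) L≤k))

  kőnig : ∀ ℓ L → TightCover ℓ L
  kőnig ℓ L = kőnig′ (length L) ℓ L ℕ.≤-refl

-- Radius-two balls and representatives of components.

module _ {A : Set} where

  first : ∀ {P : Pred A 0ℓ} → (∀ y → Dec (P y)) → A → List A → A
  first P? d [] = d
  first P? d (y ∷ ys) with P? y
  ... | yes _ = y
  ... | no  _ = first P? d ys

  first-satisfies : ∀ {P : Pred A 0ℓ} (P? : ∀ y → Dec (P y)) {d} ys → P d → P (first P? d ys)
  first-satisfies P? [] Pd = Pd
  first-satisfies P? (y ∷ ys) Pd with P? y
  ... | yes Py = Py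
  ... | no  _  = first-satisfies P? ys Pd

  -- Both searches stop at the same element; since one exists, the defaults `d` and `d′` may differ.
  first-cong : ∀ {P Q : Pred A 0ℓ} (P? : ∀ y → Dec (P y)) (Q? : ∀ y → Dec (Q y)) →
    (∀ {y} → P y → Q y) → (∀ {y} → Q y → P y) →
    ∀ {d d′ ys} → Any P ys → first P? d ys ≡ first Q? d′ ys
  first-cong P? Q? P⇒Q Q⇒P {ys = y ∷ ys} some with P? y | Q? y
  ... | yes _  | yes _  = refl
  ... | yes Py | no ¬Qy = contradiction (P⇒Q Py) ¬Qy
  ... | no ¬Py | yes Qy = contradiction (Q⇒P Qy) ¬Py
  ... | no ¬Py | no _   with some
  ...   | here Py   = contradiction Py ¬Py
  ...   | there rest = first-cong P? Q? P⇒Q Q⇒P rest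

-- Distance at most two, so `Near R x` is the closed ball of radius 2 about `x`.
Near : ∀ {n} → Rel (Fin n) 0ℓ → Rel (Fin n) 0ℓ
Near R x y = x ≡ y ⊎ R x y ⊎ ∃[ z ] (R x z × R z y)

pattern same     = inj₁ refl
pattern edge e   = inj₂ (inj₁ e)
pattern via e f  = inj₂ (inj₂ (_ , e , f))

module _ {n} {R : Rel (Fin n) 0ℓ} where

  near? : Decidable R → Decidable (Near R)
  near? R? x y = x ≟ y ⊎-dec R? x y ⊎-dec any? λ z → R? x z ×-dec R? z y

  near-sym : Symmetric R → Symmetric (Near R)
  near-sym R-sym same      = same
  near-sym R-sym (edge e)  = edge (R-sym e)
  near-sym R-sym (via e f) = via (R-sym f) (R-sym e)

  near-map : ∀ {S : Rel (Fin n) 0ℓ} → (∀ {x y} → R x y → S x y) →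
    ∀ {x y} → Near R x y → Near S x y
  near-map f same      = same
  near-map f (edge e)  = edge (f e)
  near-map f (via d e) = via (f d) (f e)

  -- For symmetric `R`, this excludes distance three, hence all larger finite distances: every
  -- component is a ball about each of its vertices.
  ThreePathsNear : Set
  ThreePathsNear = ∀ {x y z w} → R x y → R y z → R z w → Near R x w

  near-step : ThreePathsNear → ∀ {x y z} → Near R x y → R y z → Near R x z
  near-step short same      f = edge f
  near-step short (edge e)  f = via e f
  near-step short (via d e) f = short d e f

  near-trans : ThreePathsNear → ∀ {x y z} → Near R x y → Near R y z → Near R x z
  near-trans short p same      = p
  near-trans short p (edge e)  = near-step short p e
  near-trans short p (via d e) = near-step short (near-step short p d) e

  module Representative (R? : Decidable R) (R-sym : Symmetric R) (short : ThreePathsNear) where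

    -- A canonical name for the component of `x`. The search always succeeds, because `x` is near
    -- itself.
    representative : Fin n → Fin n
    representative x = first (near? R? x) x (allFin n)

    representative-near : ∀ x → Near R x (representative x)
    representative-near x = first-satisfies (near? R? x) (allFin n) same

    representative-cong : ∀ {x y} → Near R x y → representative x ≡ representative y
    representative-cong {x} {y} x~y = first-cong (near? R? x) (near? R? y)
      (near-trans short (near-sym R-sym x~y)) (near-trans short x~y)
      (lose (∈-allFin x) same)

-- Deletable configurations in a two-coloured graph.

Family : ℕ → Set₁
Family n = Fin 2 → Rel (Fin n) 0ℓ

module _ {n} (E : Family n) where

  Adjacent : Rel (Fin n) 0ℓ
  Adjacent x y = ∃[ c ] E c x y

  Separated : Rel (Fin n) 0ℓ
  Separated x y = x ≢ y × ¬ Adjacent x y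

  InBall : Fin n → Pred (Fin 2 × Fin n) 0ℓ
  InBall y (c , x) = Near (E c) x y

  -- A set of centres whose closed neighbourhood can be deleted. For edges restricted to a vertex
  -- list, `touched` forces the centres into that list.
  record Reduction : Set where
    field
      centres    : List (Fin n)
      balls      : List (Fin 2 × Fin n)
      nonempty   : ∃[ x ] x ∈ centres
      separated  : AllPairs Separated centres
      touched    : ∀ {x} → x ∈ centres → ∃ (Adjacent x)
      economical : 2 * length balls ≤ 3 * length centres
      covered    : ∀ {x y} → x ∈ centres → x ≡ y ⊎ Adjacent x y → Any (InBall y) balls

  record Duality (U : List (Fin n)) : Set where
    field
      independent : List (Fin n)
      balls       : List (Fin 2 × Fin n)
      inside      : ∀ {x} → x ∈ independent → x ∈ U
      separated   : AllPairs Separated independent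
      economical  : 2 * length balls ≤ 3 * length independent
      covered     : ∀ {y} → y ∈ U → Any (InBall y) balls

module Reduce {n} (E : Family n) (E? : ∀ c → Decidable (E c)) (E-sym : ∀ c → Symmetric (E c)) where

  adjacent? : Decidable (Adjacent E)
  adjacent? x y = any? λ c → E? c x y

  adjacent-sym : Symmetric (Adjacent E)
  adjacent-sym (c , e) = c , E-sym c e

  other : ∀ c {x y} → Adjacent E x y → ¬ E c x y → E (opposite c) x y
  other 0F (0F , e) ¬e = contradiction e ¬e
  other 0F (1F , e) ¬e = e
  other 1F (0F , e) ¬e = e
  other 1F (1F , e) ¬e = contradiction e ¬e

  split : ∀ c {x y} → Adjacent E x y → E c x y ⊎ E (opposite c) x y
  split c {x} {y} a with E? c x y
  ... | yes e = inj₁ e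
  ... | no ¬e = inj₂ (other c a ¬e)

  -- All `c`-neighbours of `u` and `v` lie within two `c`-steps of `w`; the remaining neighbours lie
  -- in the balls of the other colour about `u` and `v`.
  common-neighbour : ∀ c {w u v} → E c w u → E c w v → Separated E u v → Reduction E
  common-neighbour c {w} {u} {v} wu wv sep = record
    { centres    = u ∷ v ∷ []
    ; balls      = (c , w) ∷ (opposite c , u) ∷ (opposite c , v) ∷ []
    ; nonempty   = u , here refl
    ; separated  = (sep ∷ []) ∷ [] ∷ []
    ; touched    = λ { (here refl) → w , c , E-sym c wu
                     ; (there (here refl)) → w , c , E-sym c wv }
    ; economical = ℕ.≤-refl
    ; covered    = λ { (here refl) p → at-u p ; (there (here refl)) p → at-v p }
    }
    where
    at-u : ∀ {y} → u ≡ y ⊎ Adjacent E u y → Any _ _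
    at-u same = there (here same)
    at-u (inj₂ a) with split c a
    ... | inj₁ e = here (via wu e)
    ... | inj₂ e = there (here (edge e))
    at-v : ∀ {y} → v ≡ y ⊎ Adjacent E v y → Any _ _
    at-v same = there (there (here same))
    at-v (inj₂ a) with split c a
    ... | inj₁ e = here (via wv e)
    ... | inj₂ e = there (there (here (edge e)))

  Cliques : Set
  Cliques = ∀ c {w x y} → E c w x → E c w y → x ≡ y ⊎ Adjacent E x y

  module FarPath (cliques : Cliques) (c : Fin 2) {x₀ x₁ x₂ x₃ : Fin n}
    (e₀₁ : E c x₀ x₁) (e₁₂ : E c x₁ x₂) (e₂₃ : E c x₂ x₃) (far : ¬ Near (E c) x₀ x₃) where

    c′ = opposite c

    -- `x₁` is a common `c`-neighbour, so the ends are adjacent; colour `c` would shorten the path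
    -- to `x₃`.
    e₀₂ : E c′ x₀ x₂
    e₀₂ with cliques c (E-sym c e₀₁) e₁₂
    ... | same   = contradiction (edge e₂₃) far
    ... | inj₂ a = other c a λ e → far (via e e₂₃)

    e₁₃ : E c′ x₁ x₃
    e₁₃ with cliques c (E-sym c e₁₂) e₂₃
    ... | same   = contradiction (edge e₀₁) far
    ... | inj₂ a = other c a λ e → far (via e₀₁ e)

    -- Every c-neighbour a of x₀ is joined to x₂ or to x₃ in colour c′.
    adjacent-ends : Adjacent E x₀ x₃ → Reduction E
    adjacent-ends a₀₃ = record
      { centres    = x₀ ∷ []
      ; balls      = (c′ , x₀) ∷ []
      ; nonempty   = x₀ , here refl
      ; separated  = [] ∷ []
      ; touched    = λ { (here refl) → x₁ , c , e₀₁ }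
      ; economical = ℕ.n≤1+n 2
      ; covered    = λ { (here refl) p → here (at-x₀ p) }
      }
      where
      e₀₃ : E c′ x₀ x₃
      e₀₃ = other c a₀₃ λ e → far (edge e)

      -- An edge from `a` to `x₃` cannot have colour `c`, which would bring `x₃` within two
      -- `c`-steps of `x₀`.
      through-x₃ : ∀ {a} → E c x₀ a → a ≡ x₃ ⊎ Adjacent E a x₃ → Near (E c′) x₀ a
      through-x₃ e₀ same = contradiction (edge e₀) far
      through-x₃ e₀ (inj₂ a) = via e₀₃ (E-sym c′ (other c a λ e → far (via e₀ e)))

      at-x₀ : ∀ {a} → x₀ ≡ a ⊎ Adjacent E x₀ a → Near (E c′) x₀ a
      at-x₀ same = same
      at-x₀ (inj₂ a₀) with split c a₀
      ... | inj₂ e = edge e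
      ... | inj₁ e₀ with cliques c e₀ e₀₁
      ...   | same = via e₀₃ (E-sym c′ e₁₃)
      ...   | inj₂ a₁ with split c a₁
      -- Here `a` and `x₃` are both `c′`-neighbours of `x₁`, hence equal or adjacent.
      ...     | inj₂ e₁ = through-x₃ e₀ (cliques c′ (E-sym c′ e₁) e₁₃)
      ...     | inj₁ e₁ with cliques c (E-sym c e₁) e₁₂
      ...       | same = contradiction (via e₀ e₂₃) far
      ...       | inj₂ a₂ with split c a₂
      ...         | inj₁ e₂ = through-x₃ e₀ (cliques c (E-sym c e₂) e₂₃)
      ...         | inj₂ e₂ = via e₀₂ (E-sym c′ e₂)

    -- A c-neighbour of x₃ is joined to x₂ in colour c, or else in colour c′
    -- like x₀, and is then adjacent to x₀.
    separated-ends : ¬ Adjacent E x₀ x₃ → Reduction E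
    separated-ends ¬a₀₃ = record
      { centres    = x₀ ∷ x₃ ∷ []
      ; balls      = (c , x₁) ∷ (c′ , x₀) ∷ (c′ , x₃) ∷ []
      ; nonempty   = x₀ , here refl
      ; separated  = (((λ { refl → far same }) , ¬a₀₃) ∷ []) ∷ [] ∷ []
      ; touched    = λ { (here refl) → x₁ , c , e₀₁
                       ; (there (here refl)) → x₂ , c , E-sym c e₂₃ }
      ; economical = ℕ.≤-refl
      ; covered    = λ { (here refl) p → at-x₀ p ; (there (here refl)) p → at-x₃ p }
      }
      where
      at-x₀ : ∀ {y} → x₀ ≡ y ⊎ Adjacent E x₀ y → Any _ _
      at-x₀ same = there (here same)
      at-x₀ (inj₂ a) with split c a
      ... | inj₁ e = here (via (E-sym c e₀₁) e)
      ... | inj₂ e = there (here (edge e))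

      at-x₃ : ∀ {y} → x₃ ≡ y ⊎ Adjacent E x₃ y → Any _ _
      at-x₃ same = there (there (here same))
      at-x₃ (inj₂ a) with split c a
      ... | inj₂ e = there (there (here (edge e)))
      ... | inj₁ e₃ with cliques c e₃ (E-sym c e₂₃)
      ...   | same = here (edge e₁₂)
      ...   | inj₂ a₂ with split c a₂
      ...     | inj₁ e₂ = here (via e₁₂ (E-sym c e₂))
      ...     | inj₂ e₂ = at-x₀ (Sum.map sym adjacent-sym (cliques c′ (E-sym c′ e₂) (E-sym c′ e₀₂)))

    reduction : Reduction E
    reduction with adjacent? x₀ x₃
    ... | yes a = adjacent-ends a
    ... | no ¬a = separated-ends ¬a

  -- Both configurations are found by finite search; the failure of the first search yields
  -- `Cliques`, on which the second case relies.
  reduce : Reduction E ⊎ (∀ c → ThreePathsNear {R = E c})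
  reduce with (any? λ c → any? λ w → any? λ x → any? λ y →
    E? c w x ×-dec E? c w y ×-dec ¬? (x ≟ y) ×-dec ¬? (adjacent? x y))
  ... | yes (c , w , x , y , wx , wy , sep) = inj₁ (common-neighbour c wx wy sep)
  ... | no none with (any? λ c → any? λ x → any? λ y → any? λ z → any? λ w →
    E? c x y ×-dec E? c y z ×-dec E? c z w ×-dec ¬? (near? (E? c) x w))
  ...   | yes (c , x , y , z , w , xy , yz , zw , far) =
    inj₁ (FarPath.reduction cliques c xy yz zw far)
    where
    cliques : Cliques
    cliques c {w} {x} {y} wx wy = decidable-stable (x ≟ y ⊎-dec adjacent? x y)
      λ ¬p → none (c , w , x , y , wx , wy , ¬p ∘ inj₁ , ¬p ∘ inj₂)
  ...   | no no-far = inj₂ λ c {x} {y} {z} {w} xy yz zw → decidable-stable (near? (E? c) x w)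
    λ far → no-far (c , x , y , z , w , xy , yz , zw , far)

  component-duality : (∀ c → ThreePathsNear {R = E c}) → ∀ U → Duality E U
  component-duality short U = record
    { independent = matching
    ; balls       = cover
    ; inside      = inside
    -- Vertices joined in colour `c` have the same `c`-representative, so they are not disjoint as
    -- edges of the multigraph.
    ; separated   = AllPairs.map (λ d → (λ { refl → d 0F refl }) ,
                      λ { (c , e) → d c (representative-cong c (edge e)) }) disjoint
    ; economical  = ℕ.*-mono-≤ (ℕ.n≤1+n 2) tight
    -- A cover element is a colour with a representative, so it already names a ball.
    ; covered     = λ p → let c , q = covered p in
                      lose q (near-sym (E-sym c) (representative-near c _))
    }
    where
    open module Rep (c : Fin 2) = Representative (E? c) (E-sym c) (short c)
    open Kőnig {A = Fin n} {X = Fin n} _≟_ _≟_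
    open TightCover (kőnig representative U)

-- Induction on the set of remaining vertices.

module Induct {n} (E : Family n) (E? : ∀ c → Decidable (E c)) (E-sym : ∀ c → Symmetric (E c)) where

  open DecMembership (_≟_ {n}) using (_∈?_)

  module _ (U : List (Fin n)) where

    -- Deleting vertices only removes edges, so the vertex type `Fin n` stays fixed; `U` records
    -- which vertices remain.
    Restrict : Family n
    Restrict c x y = E c x y × x ∈ U × y ∈ U

    restrict? : ∀ c → Decidable (Restrict c)
    restrict? c x y = E? c x y ×-dec (x ∈? U) ×-dec (y ∈? U)

    restrict-sym : ∀ c → Symmetric (Restrict c)
    restrict-sym c (e , x∈U , y∈U) = E-sym c e , y∈U , x∈U

    open Reduce Restrict restrict? restrict-sym public

    unrestrict-separated : ∀ {xs} → (∀ {x} → x ∈ xs → x ∈ U) →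
      AllPairs (Separated Restrict) xs → AllPairs (Separated E) xs
    unrestrict-separated xs⊆U = AllPairs-map∈ λ { p q (x≢y , ¬a) →
      x≢y , λ { (c , e) → ¬a (c , e , xs⊆U p , xs⊆U q) } }

    unrestrict-ball : ∀ {y C} → Any (InBall Restrict y) C → Any (InBall E y) C
    unrestrict-ball = Any.map (near-map proj₁)

  module Step (U : List (Fin n)) (r : Reduction (Restrict U)) where

    open Reduction r

    Close : Pred (Fin n) 0ℓ
    Close y = Any (λ x → x ≡ y ⊎ Adjacent E x y) centres

    close? : ∀ y → Dec (Close y)
    close? y = Any.any? (λ x → x ≟ y ⊎-dec any? λ c → E? c x y) centres

    remainder : List (Fin n)
    remainder = filter (¬? ∘ close?) U

    centres⊆U : ∀ {x} → x ∈ centres → x ∈ U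
    centres⊆U p with touched p
    ... | _ , _ , _ , x∈U , _ = x∈U

    -- Some centre exists, lies in `U` and is close to itself, so the filter drops it.
    remainder<U : length remainder < length U
    remainder<U with nonempty
    ... | x , p = filter-notAll _ U (lose (centres⊆U p) λ far → far (lose p same))

    extend : Duality E remainder → Duality E U
    extend d = record
      { independent = centres ++ D.independent
      ; balls       = balls ++ D.balls
      ; inside      = [ centres⊆U , proj₁ ∘ remaining ]′ ∘ ∈-++⁻ centres
      ; separated   = AllPairs.++⁺ (unrestrict-separated U centres⊆U separated) D.separated
          -- Vertices surviving the deletion are not close to any centre, so the two independent
          -- sets can be joined.
          (All.tabulate λ p → All.tabulate λ q →
            (λ eq → proj₂ (remaining q) (lose p (inj₁ eq))) ,
            (λ a → proj₂ (remaining q) (lose p (inj₂ a))))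
      ; economical  = economical′
      ; covered     = covered′
      }
      where
      module D = Duality d

      remaining : ∀ {x} → x ∈ D.independent → x ∈ U × ¬ Close x
      remaining p = ∈-filter⁻ (¬? ∘ close?) (D.inside p)

      economical′ : 2 * length (balls ++ D.balls) ≤ 3 * length (centres ++ D.independent)
      economical′ = subst₂ _≤_
        (sym (trans (cong (2 *_) (length-++ balls)) (ℕ.*-distribˡ-+ 2 (length balls) _)))
        (sym (trans (cong (3 *_) (length-++ centres)) (ℕ.*-distribˡ-+ 3 (length centres) _)))
        (ℕ.+-mono-≤ economical D.economical)

      covered′ : ∀ {y} → y ∈ U → Any (InBall E y) (balls ++ D.balls)
      covered′ {y} y∈U with close? y
      ... | no far = Any.++⁺ʳ balls (D.covered (∈-filter⁺ (¬? ∘ close?) y∈U far))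
      ... | yes close with find close
      ...   | x , p , inj₁ eq = Any.++⁺ˡ (unrestrict-ball U (covered p (inj₁ eq)))
      ...   | x , p , inj₂ (c , e) =
        Any.++⁺ˡ (unrestrict-ball U (covered p (inj₂ (c , e , centres⊆U p , y∈U))))

  duality′ : ∀ k U → length U ≤ k → Duality E U
  duality′ zero [] _ = record
    { independent = [] ; balls = [] ; inside = id ; separated = []
    ; economical = z≤n ; covered = λ () }
  duality′ (suc k) U U≤k with reduce U
  ... | inj₁ r = extend (duality′ k remainder (s≤s⁻¹ (ℕ.≤-trans remainder<U U≤k)))
    where open Step U r
  ... | inj₂ short = record
    { independent = independent
    ; balls       = balls
    ; inside      = inside
    ; separated   = unrestrict-separated U inside separated
    ; economical  = economical
    ; covered     = unrestrict-ball U ∘ covered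
    }
    where open Duality (component-duality U short U)

  duality : ∀ U → Duality E U
  duality U = duality′ (length U) U ℕ.≤-refl

-- Least witnesses, finite subsets and padding.

least : ∀ {P : ℕ → Set} → (∀ m → Dec (P m)) → ∀ {m} → P m → ∃[ l ] (IsLeast P l × l ≤ m)
least P? {zero} Pm = zero , (Pm , λ _ _ → z≤n) , z≤n
least {P} P? {suc m} Pm with P? zero
... | yes P0 = zero , (P0 , λ _ _ → z≤n) , z≤n
... | no ¬P0 with least {P ∘ suc} (P? ∘ suc) Pm
...   | l , (Pl , minimal) , l≤m = suc l , (Pl , minimal′) , s≤s l≤m
  where
  minimal′ : ∀ j → P j → suc l ≤ j
  minimal′ zero    P0 = contradiction P0 ¬P0
  minimal′ (suc j) Pj = s≤s (minimal j Pj)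

comprehension : ∀ {n} {P : Pred (Fin n) 0ℓ} → (∀ x → Dec (P x)) → Subset n
comprehension P? = tabulate (does ∘ P?)

module _ {n} {P : Pred (Fin n) 0ℓ} (P? : ∀ x → Dec (P x)) where

  ∈-comprehension⁺ : ∀ {x} → P x → x Subset.∈ comprehension P?
  ∈-comprehension⁺ {x} Px =
    lookup⇒[]= x _ (trans (lookup∘tabulate _ x) (dec-true (P? x) Px))

  ∈-comprehension⁻ : ∀ {x} → x Subset.∈ comprehension P? → P x
  ∈-comprehension⁻ {x} p with P? x | trans (sym (lookup∘tabulate (does ∘ P?) x)) ([]=⇒lookup p)
  ... | yes Px | _ = Px

fromList : ∀ {n} → List (Fin n) → Subset n
fromList []       = ⊥
fromList (x ∷ xs) = ⁅ x ⁆ ∪ fromList xs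

∈-fromList⁻ : ∀ {n} {x : Fin n} xs → x Subset.∈ fromList xs → x ∈ xs
∈-fromList⁻ []       p = contradiction p Subset.∉⊥
∈-fromList⁻ (y ∷ xs) p with Subset.x∈p∪q⁻ ⁅ y ⁆ (fromList xs) p
... | inj₁ q = here (Subset.x∈⁅y⁆⇒x≡y y q)
... | inj₂ q = there (∈-fromList⁻ xs q)

∣⁅x⁆∪p∣ : ∀ {n} (x : Fin n) p → ¬ x Subset.∈ p → ∣ ⁅ x ⁆ ∪ p ∣ ≡ suc ∣ p ∣
∣⁅x⁆∪p∣ zero    (Subset.inside  ∷ p) x∉p = contradiction Vec.here x∉p
∣⁅x⁆∪p∣ zero    (Subset.outside ∷ p) x∉p = cong (suc ∘ ∣_∣) (Subset.∪-identityˡ p)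
∣⁅x⁆∪p∣ (suc x) (Subset.inside  ∷ p) x∉p = cong suc (∣⁅x⁆∪p∣ x p (x∉p ∘ Vec.there))
∣⁅x⁆∪p∣ (suc x) (Subset.outside ∷ p) x∉p = ∣⁅x⁆∪p∣ x p (x∉p ∘ Vec.there)

∣fromList∣ : ∀ {n} {xs : List (Fin n)} → AllPairs _≢_ xs → ∣ fromList xs ∣ ≡ length xs
∣fromList∣ {n} [] = Subset.∣⊥∣≡0 n
∣fromList∣ {xs = x ∷ xs} (x≢ ∷ distinct) =
  trans (∣⁅x⁆∪p∣ x (fromList xs) λ p → All.lookup x≢ (∈-fromList⁻ xs p) refl)
        (cong suc (∣fromList∣ distinct))

-- The family must have exactly `k` members; as members may coincide, copies of `d` fill the surplus
-- places.
pad : ∀ {A : Set} → A → ∀ k (xs : List A) → length xs ≤ k →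
  Σ[ f ∈ (Fin k → A) ] (∀ {P : Pred A 0ℓ} → Any P xs → ∃[ i ] P (f i))
pad d k       []       _        = (λ _ → d) , λ ()
pad d (suc k) (x ∷ xs) (s≤s le) with pad d k xs le
... | f , hit = (λ { zero → x ; (suc i) → f i }) ,
  λ { (here Px) → zero , Px ; (there p) → Product.map suc id (hit p) }

-- Walks, distances and diameters.

module _ {n} {G : Graph n} (H : Subgraph G) where

  open Subgraph H

  _++ʷ_ : ∀ {u v w k l} → Walk H u v k → Walk H v w l → Walk H u w (k + l)
  [] _    ++ʷ q = q
  (e ∷ p) ++ʷ q = e ∷ (p ++ʷ q)

  reverseʷ : ∀ {u v l} → Walk H u v l → Walk H v u l
  reverseʷ ([] p) = [] p
  reverseʷ {l = suc l} (e ∷ p) =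
    subst (Walk H _ _) (ℕ.+-comm l 1) (reverseʷ p ++ʷ (edge-sym e ∷ [] (proj₁ (edge⊆V e))))

  walk? : ∀ l u v → Dec (Walk H u v l)
  walk? zero u v = map′ (λ { (refl , p) → [] p }) (λ { ([] p) → refl , p })
    (u ≟ v ×-dec (u Subset.∈? V))
  walk? (suc l) u v = map′ (λ { (_ , e , p) → e ∷ p }) (λ { (e ∷ p) → _ , e , p })
    (any? λ w → edge? u w ×-dec walk? l w v)

  distanceAtMost : ∀ {u v l d} → Walk H u v l → l ≤ d → DistanceAtMost H u v d
  distanceAtMost {u} {v} p l≤d with least (λ l → walk? l u v) p
  ... | m , isLeast , m≤l = m , isLeast , ℕ.≤-trans m≤l l≤d

  distanceAtMost? : ∀ d u v → Dec (DistanceAtMost H u v d)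
  distanceAtMost? d u v = map′
    (λ { (l , l<1+d , p) → distanceAtMost p (s≤s⁻¹ l<1+d) })
    (λ { (l , (p , _) , l≤d) → l , s≤s l≤d , p })
    -- The search is strictly below its bound, hence `suc d`.
    (ℕ.anyUpTo? (λ l → walk? l u v) (suc d))

  -- The diameter has to be an actual least value; it is found by a decidable search up to `d`.
  diameterAtMost : ∀ {d} → (∀ {u v} → u Subset.∈ V → v Subset.∈ V → DistanceAtMost H u v d) →
    DiameterAtMost H d
  diameterAtMost bound = least within? bound
    where
    within? : ∀ d → Dec (∀ {u v} → u Subset.∈ V → v Subset.∈ V → DistanceAtMost H u v d)
    within? d = map′ (λ f {u} {v} → f u v) (λ f u v → f)
      (all? λ u → all? λ v → (u Subset.∈? V) →-dec (v Subset.∈? V) →-dec distanceAtMost? d u v)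

-- Monochromatic balls as subgraphs.

module ColourBalls {n} {G : Graph n} {r} (c : EdgeColouring G r) where

  open Graph G renaming (sym to Adj-sym)
  open EdgeColouring c

  Coloured : Fin r → Rel (Fin n) 0ℓ
  Coloured i u v = Σ[ e ∈ Adj u v ] colour e ≡ i

  -- Deciding with one proof of adjacency suffices: any two proofs have the colour of the reversed
  -- edge.
  coloured? : ∀ i → Decidable (Coloured i)
  coloured? i u v with adj? u v
  ... | no ¬e = no (¬e ∘ proj₁)
  ... | yes e = map′ (e ,_)
    (λ { (e′ , eq) →
      trans (unordered e (Adj-sym e)) (trans (sym (unordered e′ (Adj-sym e))) eq) })
    (colour e ≟ i)

  coloured-sym : ∀ i → Symmetric (Coloured i)
  coloured-sym i (e , eq) = Adj-sym e , trans (unordered (Adj-sym e) e) eq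

  module _ (i : Fin r) (x : Fin n) where

    inBall? : ∀ y → Dec (Near (Coloured i) x y)
    inBall? = near? (coloured? i) x

    ball : Subgraph G
    ball = record
      { V        = comprehension inBall?
      ; nonempty = x , ∈-comprehension⁺ inBall? same
      -- Edges of other colours inside the ball are left out, so the subgraph need not be induced.
      ; Edge     = λ u v → Coloured i u v ×
                     u Subset.∈ comprehension inBall? × v Subset.∈ comprehension inBall?
      ; edge?    = λ u v → coloured? i u v ×-dec (u Subset.∈? _) ×-dec (v Subset.∈? _)
      ; edge-sym = λ { (e , u∈ , v∈) → coloured-sym i e , v∈ , u∈ }
      ; edge⊆Adj = proj₁ ∘ proj₁
      ; edge⊆V   = proj₂
      }

    ball-monochromatic : Monochromatic c ball
    ball-monochromatic ((_ , eq) , _) ((_ , eq′) , _) = trans eq (sym eq′)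

    -- A path of length at most two from the centre stays in the ball, so it is a walk of the
    -- subgraph itself.
    from-centre : ∀ {y} → Near (Coloured i) x y → ∃[ l ] (Walk ball x y l × l ≤ 2)
    from-centre same = 0 , [] (∈-comprehension⁺ inBall? same) , z≤n
    from-centre (edge e) = 1 , (e , x∈ , y∈) ∷ [] y∈ , s≤s z≤n
      where
      x∈ = ∈-comprehension⁺ inBall? same
      y∈ = ∈-comprehension⁺ inBall? (edge e)
    from-centre (via e f) = 2 , (e , x∈ , z∈) ∷ (f , z∈ , y∈) ∷ [] y∈ , ℕ.≤-refl
      where
      x∈ = ∈-comprehension⁺ inBall? same
      z∈ = ∈-comprehension⁺ inBall? (edge e)
      y∈ = ∈-comprehension⁺ inBall? (via e f)

    -- The walk passes through the centre, whence 4 = 2 + 2.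
    ball-walk : ∀ {u v} → u Subset.∈ Subgraph.V ball → v Subset.∈ Subgraph.V ball →
      ∃[ l ] (Walk ball u v l × l ≤ 4)
    ball-walk u∈ v∈
      with from-centre (∈-comprehension⁻ inBall? u∈) | from-centre (∈-comprehension⁻ inBall? v∈)
    ... | k , p , k≤2 | l , q , l≤2 =
      k + l , _++ʷ_ ball (reverseʷ ball p) q , ℕ.+-mono-≤ k≤2 l≤2

    ball-connected : Connected ball
    ball-connected u∈ v∈ = Product.map₂ proj₁ (ball-walk u∈ v∈)

    ball-diameter : DiameterAtMost ball 4
    ball-diameter = diameterAtMost ball λ u∈ v∈ → let _ , p , l≤4 = ball-walk u∈ v∈ in
      distanceAtMost ball p l≤4

-- The bound in terms of the independence number.

length≤independenceNumber : ∀ {n α} (G : Graph n) → IsIndependenceNumber G α → ∀ {I} →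
  AllPairs (λ u v → u ≢ v × ¬ Graph.Adj G u v) I → length I ≤ α
length≤independenceNumber G (_ , greatest) {I} sep = greatest (length I)
  (fromList I , independent , ∣fromList∣ (AllPairs.map proj₁ sep))
  where
  open Graph G renaming (sym to Adj-sym)
  independent : Independent G (fromList I)
  independent {u} {v} u∈ v∈ e with u ≟ v
  ... | yes u≡v = irrefl u≡v e
  ... | no u≢v = proj₂ (AllPairs-lookup
    (λ { (x≢y , ¬e) → x≢y ∘ sym , ¬e ∘ Adj-sym }) sep
    (∈-fromList⁻ I u∈) (∈-fromList⁻ I v∈) u≢v) e

-- Provides the centre of the padding ball; a graph without vertices has independence number 0.
positive⇒vertex : ∀ {n α} (G : Graph n) → IsIndependenceNumber G α → 1 ≤ α → Fin n
positive⇒vertex {zero}  G (([] , _ , refl) , _) ()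
positive⇒vertex {suc n} G _ _ = zero

m*2≤n⇒m≤n/2 : ∀ {m n} → 2 * m ≤ n → m ≤ n / 2
m*2≤n⇒m≤n/2 {m} {n} le = subst (_≤ n / 2) (m*n/n≡m m 2)
  (/-monoˡ-≤ 2 (subst (_≤ n) (ℕ.*-comm 2 m) le))

cover-by-balls : ∀ {n α} (G : Graph n) → 1 ≤ α → IsIndependenceNumber G α →
  (c : EdgeColouring G 2) →
  Σ[ H ∈ (Fin (3 * α / 2) → Subgraph G) ]
    ((∀ i → Monochromatic c (H i) × Connected (H i) × DiameterAtMost (H i) 4) × Covers H)
cover-by-balls {n} {α} G 1≤α isα c =
  (λ i → ball (proj₁ (f i)) (proj₂ (f i))) ,
  (λ i → let j , x = f i in ball-monochromatic j x , ball-connected j x , ball-diameter j x) ,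
  λ v → let i , near = hit (covered (∈-allFin v)) in
    i , ∈-comprehension⁺ (inBall? (proj₁ (f i)) (proj₂ (f i))) near
  where
  open ColourBalls c
  open Duality (Induct.duality Coloured coloured? coloured-sym (allFin n))

  few : length balls ≤ 3 * α / 2
  -- Twice the number of balls is at most three times the size of an independent set, hence at most
  -- `3 * α`.
  few = m*2≤n⇒m≤n/2 (ℕ.≤-trans economical (ℕ.*-monoʳ-≤ 3
    (length≤independenceNumber G isα
      (AllPairs.map (Product.map₂ λ ¬a e → ¬a (EdgeColouring.colour c e , e , refl)) separated))))

  padded = pad (zero , positive⇒vertex G isα 1≤α) (3 * α / 2) balls few
  f = proj₁ padded
  hit : ∀ {P : Pred (Fin 2 × Fin n) 0ℓ} → Any P balls → ∃[ i ] P (f i)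
  hit = proj₂ padded

theorem2p5 : (α : ℕ) → 1 ≤ α →
    (∀ {n} (G : Graph n) → IsIndependenceNumber G α → (c : EdgeColouring G 2) →
    Σ[ H ∈ (Fin (3 * α / 2) → Subgraph G) ]
    ((∀ i → Monochromatic c (H i) × Connected (H i) × DiameterAtMost (H i) 4)
    × Covers H))
    × (∀ m → g 2 4 α m → m ≤ 3 * α / 2)
theorem2p5 α 1≤α = (λ G → cover-by-balls G 1≤α) , λ m (_ , minimal) →
  minimal (3 * α / 2) λ G isα c →
    let H , good , covers = cover-by-balls G 1≤α isα c in
    H , (λ i → let mono , _ , diameter = good i in mono , diameter) , covers
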